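{- Let $\mathcal{S}$ be a nonempty set with a scene space basis $\mathcal{B}$. Let $P,Q$ be programs over $\mathcal{S}$ and $F:\mathcal{S}\to\{\text{true},\text{false}\}$ a formula such that $Q$ does not interfere with $F$. Then $[P]F \implies [P\parallel Q]F$; that is, for every state $s\in\mathcal{S}$, if $([P]F)(s)$ holds then $([P\parallel Q]F)(s)$ holds.
   Context: Scenes. Let $\mathcal{S}$ be a nonempty set (of states). A scene on $\mathcal{S}$ is a function $A:\mathcal{S}\to\mathcal{S}\to\mathcal{S}$, also written $\mathrm{mrg}_A$, satisfying for all $x,y,z$: $A\,(A\,x\,y)\,z = A\,x\,z$, $A\,x\,(A\,y\,z)=A\,x\,z$, $A\,x\,x=x$. Write $\bot = (\lambda s_1\,s_2.\ s_1)$, $\top=(\lambda s_1\,s_2.\ s_2)$, $A^{\complement}=(\lambda s_1\,s_2.\ A\,s_2\,s_1)$, $A\sqcup B=(\lambda s_1\,s_2.\ B\,(A\,s_1\,s_2)\,s_2)$. Scenes $A,B$ are independent if $B\,(A\,s_1\,s_2)\,s_3=A\,(B\,s_1\,s_3)\,s_2$ for all $s_1,s_2,s_3$. Write "$s_1\approx s_2$ on $A$" for $A\,s_1\,s_2=s_1$. A scene space basis is a finite sequence of scenes $S_1,\dots,S_n$ with $S_i,S_j$ independent for $i\neq j$ and $S_1\sqcup\cdots\sqcup S_n=\top$; $\mathcal{B}=\{S_1,\dots,S_n\}$. For a set $X\subseteq\mathcal{B}$, $\bigcup X$ denotes the $\sqcup$ of all its elements (in any order, the result being independent of it), with $\bigcup\emptyset=\bot$.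 A program is a binary predicate $P(s,s')$ on $\mathcal{S}$. A formula is a Boolean-valued function on $\mathcal{S}$. $FV(F)=\{x\in\mathcal{B} : \exists s,s'.\ s\approx s' \text{ on } x^{\complement} \text{ and } F(s)\ne F(s')\}$. $BV(P)=\{x\in\mathcal{B} : \exists s_0,s_0'.\ P(s_0,s_0') \text{ and not } (s_0\approx s_0' \text{ on } x)\}$. Program $P$ does not interfere with formula $F$ if $BV(P)\cap FV(F)=\emptyset$. Box: $([P]F)(s)$ holds iff $F(s')$ holds for all $s'$ with $P(s,s')$. Parallel composition: $(P\parallel Q)(s,s')$ iff there exist $s_P,s_Q\in\mathcal{S}$ with $P(s,s_P)$, $Q(s,s_Q)$ and $s'=\mathrm{mrg}_{\bigcup BV(P)}\,s_Q\,s_P$. -}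

module Defs where

open import Algebra.Core using (Op₂)
open import Data.Bool.Base using (Bool; T)
open import Data.Fin.Base using (Fin)
open import Data.Fin.Properties using (_≟_)
open import Data.List.Base using (List; []; _∷_; foldr; tabulate; filter; allFin; map)
open import Data.List.Membership.Propositional using (_∈_)
open import Data.List.Membership.Propositional.Properties
  using (∈-map⁺; ∈-map⁻; ∈-filter⁺; ∈-filter⁻; ∈-allFin)
open import Data.List.Relation.Unary.Any using (here; there)
open import Data.Nat.Base using (ℕ)
open import Data.Product.Base using (∃; ∃-syntax; _×_; _,_; proj₁; proj₂)
open import Function.Base using (_∘_)
open import Function.Bundles using (_⇔_; mk⇔; Equivalence)
open import Level using (Level; _⊔_)
open import Relation.Binary.Core using (Rel)
open import Relation.Binary.PropositionalEquality
open import Relation.Nullary using (¬_; Dec; yes; no)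
open import Relation.Unary using (Pred; Empty; _∩_; _⊆_)

private variable
  a p q ℓ : Level
  𝒮 : Set a

record IsScene {𝒮 : Set a} (A : Op₂ 𝒮) : Set a where
  field
    mrg-left  : ∀ x y z → A (A x y) z ≡ A x z
    mrg-right : ∀ x y z → A x (A y z) ≡ A x z
    mrg-idem  : ∀ x → A x x ≡ x

⊥ₛ ⊤ₛ : Op₂ 𝒮
⊥ₛ s₁ s₂ = s₁
⊤ₛ s₁ s₂ = s₂

infix 8 _ᶜ
_ᶜ : Op₂ 𝒮 → Op₂ 𝒮
(A ᶜ) s₁ s₂ = A s₂ s₁

-- The join is taken on bare functions: the join of two scenes
-- that are not independent need not be a scene.
infixr 6 _⊔ₛ_
_⊔ₛ_ : Op₂ 𝒮 → Op₂ 𝒮 → Op₂ 𝒮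
(A ⊔ₛ B) s₁ s₂ = B (A s₁ s₂) s₂

⨆ : List (Op₂ 𝒮) → Op₂ 𝒮
⨆ = foldr _⊔ₛ_ ⊥ₛ

infix 4 _≐_
_≐_ : {𝒮 : Set a} → Op₂ 𝒮 → Op₂ 𝒮 → Set a
A ≐ B = ∀ s₁ s₂ → A s₁ s₂ ≡ B s₁ s₂

Independent : {𝒮 : Set a} → Op₂ 𝒮 → Op₂ 𝒮 → Set a
Independent A B = ∀ s₁ s₂ s₃ → B (A s₁ s₂) s₃ ≡ A (B s₁ s₃) s₂

infix 4 _≈_on_
_≈_on_ : {𝒮 : Set a} → 𝒮 → 𝒮 → Op₂ 𝒮 → Set a
s₁ ≈ s₂ on A = A s₁ s₂ ≡ s₁

record SceneSpaceBasis (𝒮 : Set a) : Set a where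
  field
    size        : ℕ
    scene       : Fin size → Op₂ 𝒮
    isScene     : ∀ i → IsScene (scene i)
    independent : ∀ i j → i ≢ j → Independent (scene i) (scene j)
    spanning    : ⨆ (tabulate scene) ≐ ⊤ₛ

Program : Set a → (p : Level) → Set _
Program 𝒮 p = Rel 𝒮 p

Formula : Set a → Set a
Formula 𝒮 = 𝒮 → Bool

module _ {𝒮 : Set a} where

  [_]_ : Program 𝒮 p → Formula 𝒮 → Pred 𝒮 _
  ([ P ] F) s = ∀ s′ → P s s′ → T (F s′)

  -- Subsets of 𝓑 need not be decidable, so ⋃ X is given by its graph:
  -- U is the join of the elements of X, listed in some order.  Repetitions
  -- in the list are harmless because ⊔ₛ is idempotent on scenes.
  -- See ⋃-unique and ⋃-exists below.
  Is⋃ : Pred (Op₂ 𝒮) ℓ → Op₂ 𝒮 → Set _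
  Is⋃ X U = ∃[ xs ] (∀ x → x ∈ xs ⇔ X x) × U ≐ ⨆ xs

module Space {𝒮 : Set a} (basis : SceneSpaceBasis 𝒮) where
  open SceneSpaceBasis basis

  𝓑 : Pred (Op₂ 𝒮) a
  𝓑 x = ∃[ i ] x ≡ scene i

  FV : Formula 𝒮 → Pred (Op₂ 𝒮) a
  FV F x = 𝓑 x × ∃[ s ] ∃[ s′ ] (s ≈ s′ on x ᶜ) × F s ≢ F s′

  BV : Program 𝒮 p → Pred (Op₂ 𝒮) (a ⊔ p)
  BV P x = 𝓑 x × ∃[ s₀ ] ∃[ s₀′ ] P s₀ s₀′ × ¬ (s₀ ≈ s₀′ on x)

  DoesNotInterfere : Program 𝒮 p → Formula 𝒮 → Set _
  DoesNotInterfere P F = Empty (BV P ∩ FV F)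

  infixr 5 _∥_
  _∥_ : Program 𝒮 p → Program 𝒮 q → Program 𝒮 (a ⊔ p ⊔ q)
  (P ∥ Q) s s′ = ∃[ s-P ] ∃[ s-Q ] ∃[ U ]
    P s s-P × Q s s-Q × Is⋃ (BV P) U × s′ ≡ U s-Q s-P

  private
    idem : ∀ {x} → 𝓑 x → ∀ s t → x (x s t) t ≡ x s t
    idem (i , refl) s t = IsScene.mrg-left (isScene i) s t t

    comm : ∀ {x y} → 𝓑 x → 𝓑 y → ∀ s t → y (x s t) t ≡ x (y s t) t
    comm (i , refl) (j , refl) s t with i ≟ j
    ... | yes refl = refl
    ... | no  i≢j  = independent i j i≢j s t t

    ⨆-comm₁ : ∀ {x} ys → 𝓑 x → (∀ {y} → y ∈ ys → 𝓑 y) →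
              ∀ s t → ⨆ ys (x s t) t ≡ x (⨆ ys s t) t
    ⨆-comm₁ []       bx bys s t = refl
    ⨆-comm₁ (y ∷ ys) bx bys s t = trans
      (cong (λ r → ⨆ ys r t) (comm bx (bys (here refl)) s t))
      (⨆-comm₁ ys bx (bys ∘ there) (y s t) t)

    ⨆-comm : ∀ xs ys → (∀ {x} → x ∈ xs → 𝓑 x) → (∀ {y} → y ∈ ys → 𝓑 y) →
             ∀ s t → ⨆ ys (⨆ xs s t) t ≡ ⨆ xs (⨆ ys s t) t
    ⨆-comm []       ys bxs bys s t = refl
    ⨆-comm (x ∷ xs) ys bxs bys s t = trans
      (⨆-comm xs ys (bxs ∘ there) bys (x s t) t)
      (cong (λ r → ⨆ xs r t) (⨆-comm₁ ys (bxs (here refl)) bys s t))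

    ⨆-absorb₁ : ∀ {x} ys → x ∈ ys → (∀ {y} → y ∈ ys → 𝓑 y) →
                ∀ s t → ⨆ ys (x s t) t ≡ ⨆ ys s t
    ⨆-absorb₁ (y ∷ ys) (here refl) bys s t =
      cong (λ r → ⨆ ys r t) (idem (bys (here refl)) s t)
    ⨆-absorb₁ (y ∷ ys) (there x∈) bys s t = trans
      (cong (λ r → ⨆ ys r t) (comm (bys (there x∈)) (bys (here refl)) s t))
      (⨆-absorb₁ ys x∈ (bys ∘ there) (y s t) t)

    ⨆-absorb : ∀ xs ys → (∀ {x} → x ∈ xs → x ∈ ys) → (∀ {y} → y ∈ ys → 𝓑 y) →
               ∀ s t → ⨆ ys (⨆ xs s t) t ≡ ⨆ ys s t
    ⨆-absorb []       ys sub bys s t = refl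
    ⨆-absorb (x ∷ xs) ys sub bys s t = trans
      (⨆-absorb xs ys (sub ∘ there) bys (x s t) t)
      (⨆-absorb₁ ys (sub (here refl)) bys s t)

  ⋃-unique : {X : Pred (Op₂ 𝒮) ℓ} → X ⊆ 𝓑 →
             ∀ {U V} → Is⋃ X U → Is⋃ X V → U ≐ V
  ⋃-unique X⊆𝓑 {U} {V} (xs , xs⇔X , U≐) (ys , ys⇔X , V≐) s t = begin
    U s t                ≡⟨ U≐ s t ⟩
    ⨆ xs s t             ≡⟨ ⨆-absorb ys xs (λ {x} → from (xs⇔X x) ∘ to (ys⇔X x)) bxs s t ⟨
    ⨆ xs (⨆ ys s t) t    ≡⟨ ⨆-comm ys xs bys bxs s t ⟩
    ⨆ ys (⨆ xs s t) t    ≡⟨ ⨆-absorb xs ys (λ {x} → from (ys⇔X x) ∘ to (xs⇔X x)) bys s t ⟩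
    ⨆ ys s t             ≡⟨ V≐ s t ⟨
    V s t                ∎
    where
    open ≡-Reasoning
    open Equivalence
    bxs : ∀ {x} → x ∈ xs → 𝓑 x
    bxs {x} = X⊆𝓑 ∘ to (xs⇔X x)
    bys : ∀ {y} → y ∈ ys → 𝓑 y
    bys {y} = X⊆𝓑 ∘ to (ys⇔X y)

  -- The decidability hypothesis always holds classically.
  ⋃-exists : {X : Pred (Op₂ 𝒮) ℓ} → X ⊆ 𝓑 →
             (∀ i → Dec (X (scene i))) → ∃ (Is⋃ X)
  ⋃-exists {X = X} X⊆𝓑 X? = ⨆ xs , xs , (λ x → mk⇔ sound complete) , λ _ _ → refl
    where
    is = filter X? (allFin size)
    xs = map scene is
    sound : ∀ {x} → x ∈ xs → X x
    sound x∈ with ∈-map⁻ scene x∈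
    ... | i , i∈ , refl = proj₂ (∈-filter⁻ X? {xs = allFin size} i∈)
    complete : ∀ {x} → X x → x ∈ xs
    complete Xx with X⊆𝓑 Xx
    ... | i , refl = ∈-map⁺ scene (∈-filter⁺ X? (∈-allFin i) Xx)

{-# OPTIONS --safe #-}

-- Let s′ be the merged final state and s-P the final state of P.  Whatever
-- the state t, overwriting a single basis scene x of t by s′ or by s-P gives
-- the same value of F: s′ and s-P agree on x if x is in BV P, and also if x
-- is in neither BV P nor BV Q, since then neither program changes x; in the
-- remaining case x is in BV Q, hence not in FV F.  As the basis scenes are
-- pairwise independent, the scenes can be overwritten one after the other,
-- and as they span, F s′ = F s-P.
module Submission where

open import Data.Bool.Base using (T)
import Data.Bool.Properties as Bool
open import Algebra.Core using (Op₂)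
open import Data.Fin.Base using (Fin; zero; suc)
open import Data.Fin.Properties using (_≟_; suc-injective)
open import Data.List.Base using ([]; _∷_; tabulate)
open import Data.List.Membership.Propositional using (_∈_)
open import Data.List.Relation.Unary.Any using (here; there)
open import Data.Nat.Base using (zero; suc)
open import Data.Product.Base using (_,_; proj₁)
open import Function.Base using (_∘_)
open import Function.Bundles using (Equivalence)
open import Level using (Level)
open import Relation.Binary.PropositionalEquality
  using (_≡_; _≢_; refl; sym; trans; cong; subst; module ≡-Reasoning)
open import Relation.Nullary using (yes; no)
open import Relation.Nullary.Decidable using (decidable-stable)
open import Defs

private variable
  a : Level
  𝒮 : Set a

-- Writing `u` as `A u u` lets independence move `A` outside `B`; the outer `A` then restores the
-- part of `u` that it reads.
independent-agree : {A B : Op₂ 𝒮} → IsScene A → Independent A B →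
                    ∀ r u v → A r (B u v) ≡ A r u
independent-agree {A = A} {B} isA A⊥B r u v = begin
  A r (B u v)          ≡⟨ cong (λ w → A r (B w v)) (mrg-idem u) ⟨
  A r (B (A u u) v)    ≡⟨ cong (A r) (A⊥B u u v) ⟩
  A r (A (B u v) u)    ≡⟨ mrg-right r (B u v) u ⟩
  A r u                ∎
  where
  open ≡-Reasoning
  open IsScene isA

≈-on⇒agree : {A : Op₂ 𝒮} → IsScene A → ∀ {u v} → u ≈ v on A →
             ∀ r → A r u ≡ A r v
≈-on⇒agree {A = A} isA {u} {v} u≈v r =
  trans (cong (A r) (sym u≈v)) (IsScene.mrg-right isA r u v)

⨆-independent : ∀ {n} (A : Op₂ 𝒮) (f : Fin n → Op₂ 𝒮) →
                (∀ i → Independent A (f i)) → Independent A (⨆ (tabulate f))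
⨆-independent {n = zero}  A f A⊥f s t u = refl
⨆-independent {n = suc n} A f A⊥f s t u = trans
  (cong (λ r → ⨆ (tabulate (f ∘ suc)) r u) (A⊥f zero s t u))
  (⨆-independent A (f ∘ suc) (A⊥f ∘ suc) (f zero s u) t u)

⨆-formula-cong : ∀ {n} (f : Fin n → Op₂ 𝒮) (F : Formula 𝒮) {u v : 𝒮} →
                 (∀ i j → i ≢ j → Independent (f i) (f j)) →
                 (∀ i t → F (f i t u) ≡ F (f i t v)) →
                 ∀ t → F (⨆ (tabulate f) t u) ≡ F (⨆ (tabulate f) t v)
⨆-formula-cong {n = zero}  f F         f⊥f F≡ t = refl
⨆-formula-cong {n = suc n} f F {u} {v} f⊥f F≡ t = begin
  F (fs (f zero t u) u)    ≡⟨ ⨆-formula-cong (f ∘ suc) F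
                                (λ i j i≢j → f⊥f (suc i) (suc j) (i≢j ∘ suc-injective))
                                (F≡ ∘ suc) (f zero t u) ⟩
  -- The intermediate state takes `u` on `f zero` and `v` on the rest. Independence allows two
  -- different sources, so `f zero` can be moved outermost, where the hypothesis on a single scene
  -- applies.
  F (fs (f zero t u) v)    ≡⟨ cong F (f₀⊥fs t u v) ⟩
  F (f zero (fs t v) u)    ≡⟨ F≡ zero (fs t v) ⟩
  F (f zero (fs t v) v)    ≡⟨ cong F (f₀⊥fs t v v) ⟨
  F (fs (f zero t v) v)    ∎
  where
  open ≡-Reasoning
  fs = ⨆ (tabulate (f ∘ suc))
  f₀⊥fs : Independent (f zero) fs
  f₀⊥fs = ⨆-independent (f zero) (f ∘ suc) λ i → f⊥f zero (suc i) λ ()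

module _ {𝒮 : Set a} (basis : SceneSpaceBasis 𝒮) where
  open SceneSpaceBasis basis
  open Space basis

  -- Each entry of `ys` is either `scene i`, which copies its part from `v`, or independent of it
  -- and leaves that part alone. Agreement with `v` on `scene i` thus survives every merge.
  ⨆-agree : ∀ i ys → (∀ {y} → y ∈ ys → 𝓑 y) →
            ∀ r u v → scene i r u ≡ scene i r v →
            scene i r (⨆ ys u v) ≡ scene i r v
  ⨆-agree i []       bys r u v eq = eq
  ⨆-agree i (y ∷ ys) bys r u v eq =
    ⨆-agree i ys (bys ∘ there) r (y u v) v (step (bys (here refl)))
    where
    step : 𝓑 y → scene i r (y u v) ≡ scene i r v
    step (j , refl) with i ≟ j
    ... | yes refl = IsScene.mrg-right (isScene i) r u v
    ... | no  i≢j  = trans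
      (independent-agree (isScene i) (independent i j i≢j) r u v) eq

  -- Merging along `scene i` itself creates the agreement with `v`, whatever came before; the later
  -- entries preserve it by `⨆-agree`.
  ⨆-agree-∈ : ∀ i ys → (∀ {y} → y ∈ ys → 𝓑 y) → scene i ∈ ys →
              ∀ r u v → scene i r (⨆ ys u v) ≡ scene i r v
  ⨆-agree-∈ i (y ∷ ys) bys (here refl) r u v =
    ⨆-agree i ys (bys ∘ there) r (y u v) v (IsScene.mrg-right (isScene i) r u v)
  ⨆-agree-∈ i (y ∷ ys) bys (there i∈) r u v =
    ⨆-agree-∈ i ys (bys ∘ there) i∈ r (y u v) v

  ≢⇒∈FV : ∀ F i {t u v} → F (scene i t u) ≢ F (scene i t v) → FV F (scene i)
  ≢⇒∈FV F i {t} {u} {v} F≢ = (i , refl) , scene i t u , scene i t v ,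
    trans (mrg-left t v (scene i t u)) (mrg-right t t u) , F≢
    where open IsScene (isScene i)

theorem47 : {a p q : Level} (𝒮 : Set a) → 𝒮 → (basis : SceneSpaceBasis 𝒮) → let open Space basis in
    (P : Program 𝒮 p) (Q : Program 𝒮 q) (F : Formula 𝒮) →
    DoesNotInterfere Q F →
    ∀ s → ([ P ] F) s → ([ P ∥ Q ] F) s
theorem47 𝒮 _ basis P Q F noInterference s [P]F s′
  (s-P , s-Q , U , Pss-P , Qss-Q , (xs , xs⇔BV , U≐⨆) , s′≡) =
  subst T (sym Fs′≡Fs-P) ([P]F s-P Pss-P)
  where
  open SceneSpaceBasis basis
  open Space basis

  m : 𝒮
  m = ⨆ xs s-Q s-P

  bxs : ∀ {x} → x ∈ xs → 𝓑 x
  bxs {x} = proj₁ ∘ Equivalence.to (xs⇔BV x)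

  F≡ : ∀ i t → F (scene i t m) ≡ F (scene i t s-P)
  -- Equality of Booleans is stable, so a refutation suffices; this avoids deciding membership in
  -- `BV P` or `BV Q`.
  F≡ i t = decidable-stable (_ Bool.≟ _) λ F≢ →
    noInterference (scene i) (((i , refl) , s , s-Q , Qss-Q , λ s≈s-Q →
      F≢ (cong F (⨆-agree-∈ basis i xs bxs
        (Equivalence.from (xs⇔BV (scene i)) ((i , refl) , s , s-P , Pss-P , λ s≈s-P →
          -- Here neither program changes `scene i`, so `s-Q` and `s-P` agree there, both through
          -- the initial state `s`.
          F≢ (cong F (⨆-agree basis i xs bxs t s-Q s-P (trans
            (sym (≈-on⇒agree (isScene i) s≈s-Q t))
            (≈-on⇒agree (isScene i) s≈s-P t))))))
        t s-Q s-P))) ,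
      ≢⇒∈FV basis F i F≢)

  Fs′≡Fs-P : F s′ ≡ F s-P
  Fs′≡Fs-P = begin
    F s′                         ≡⟨ cong F (trans s′≡ (U≐⨆ s-Q s-P)) ⟩
    -- The join of the whole basis overwrites the base state completely, so `s` here could be any
    -- state.
    F m                          ≡⟨ cong F (spanning s m) ⟨
    F (⨆ (tabulate scene) s m)   ≡⟨ ⨆-formula-cong scene F independent F≡ s ⟩
    F (⨆ (tabulate scene) s s-P) ≡⟨ cong F (spanning s s-P) ⟩
    F s-P                        ∎
    where open ≡-Reasoning
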